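{- There is an algorithm that solves Permutation Pattern Matching, i.e., that decides for every $n$-permutation $T$ and every $k$-permutation $P$ with $k\le n$ whether there is a matching of $P$ into $T$, in time $\mathcal{O}(1.79^{n}\cdot n\cdot k)$.
   Context: For $m\in\mathbb{N}$, $[m]=\{1,\dots,m\}$; an $m$-permutation is a bijection $\pi:[m]\to[m]$, viewed as the sequence $\pi(1),\dots,\pi(m)$. Permutation Pattern Matching (PPM): Instance: an $n$-permutation $T$ (the text) and a $k$-permutation $P$ (the pattern) with $k\le n$. Question: is there a matching of $P$ into $T$, i.e., a monotonically (strictly) increasing map $M:[k]\to[n]$ such that the sequence $(M(P(1)),M(P(2)),\dots,M(P(k)))$ is a subsequence of $T$? Running times refer to the random access machine (RAM) model in which elementary arithmetic operations (addition, subtraction, multiplication, modulo) take constant time. -}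

module Defs where

open import Data.Bool using (if_then_else_)
open import Data.Fin as Fin using (Fin; toℕ)
open import Data.Fin.Permutation using (Permutation′; _⟨$⟩ʳ_)
open import Data.List using (List; []; _∷_; _++_; drop; head; tabulate)
open import Data.List.Relation.Binary.Sublist.Propositional using (_⊆_)
open import Data.Maybe as Maybe using (Maybe; just; nothing; fromMaybe)
open import Data.Nat
open import Data.Product using (_×_; ∃-syntax)
open import Data.Sum using (_⊎_)
open import Relation.Binary.Core using (_Preserves_⟶_)
open import Relation.Binary.PropositionalEquality using (_≡_)
open import Relation.Nullary using (¬_)

-- [m] = {1,…,m} is represented by Fin m, so i ∈ [m]
-- corresponds to the index of ℕ-value i ∸ 1.

sequence : ∀ {m} → Permutation′ m → List (Fin m)
sequence π = tabulate (π ⟨$⟩ʳ_)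

-- _⊆_ is the (not necessarily contiguous) subsequence relation on lists.
IsMatching : ∀ {n k} → Permutation′ n → Permutation′ k → (Fin k → Fin n) → Set
IsMatching T P M =
  (M Preserves Fin._<_ ⟶ Fin._<_) ×
  (tabulate (λ i → M (P ⟨$⟩ʳ i)) ⊆ sequence T)

HasMatching : ∀ {n k} → Permutation′ n → Permutation′ k → Set
HasMatching T P = ∃[ M ] IsMatching T P M

-- Unit-cost random access machine (no bound on word size): a program is a fixed finite list of
-- instructions, acting on registers (named directly by instructions) and on a
-- memory that is addressed indirectly through registers.  Both hold natural
-- numbers, and every instruction takes one time unit.

Register Label : Set
Register = ℕ
Label    = ℕ

-- Subtraction is truncated at 0 as words are natural numbers.
data ArithOp : Set where
  add sub mul mod : ArithOp

data Instr : Set where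
  const : Register → ℕ → Instr
  move  : Register → Register → Instr
  arith : ArithOp → Register → Register → Register → Instr
  load  : Register → Register → Instr
  store : Register → Register → Instr
  jump  : Label → Instr
  jumpZ : Register → Label → Instr

Program : Set
Program = List Instr

record State : Set where
  constructor ⟨_,_,_⟩
  field
    pc  : ℕ
    reg : ℕ → ℕ
    mem : ℕ → ℕ

open State public

_[_≔_] : (ℕ → ℕ) → ℕ → ℕ → (ℕ → ℕ)
(f [ a ≔ v ]) b = if a ≡ᵇ b then v else f b

-- The value of mod for divisor 0 is an arbitrary totalisation.
⟦_⟧ : ArithOp → ℕ → ℕ → ℕ
⟦ add ⟧ x y       = x + y
⟦ sub ⟧ x y       = x ∸ y
⟦ mul ⟧ x y       = x * y
⟦ mod ⟧ x zero    = x
⟦ mod ⟧ x (suc y) = x % suc y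

exec : State → Instr → State
exec ⟨ p , r , m ⟩ (const d v)      = ⟨ suc p , r [ d ≔ v ] , m ⟩
exec ⟨ p , r , m ⟩ (move d x)       = ⟨ suc p , r [ d ≔ r x ] , m ⟩
exec ⟨ p , r , m ⟩ (arith op d x y) = ⟨ suc p , r [ d ≔ ⟦ op ⟧ (r x) (r y) ] , m ⟩
exec ⟨ p , r , m ⟩ (load d a)       = ⟨ suc p , r [ d ≔ m (r a) ] , m ⟩
exec ⟨ p , r , m ⟩ (store a x)      = ⟨ suc p , r , m [ r a ≔ r x ] ⟩
exec ⟨ p , r , m ⟩ (jump l)         = ⟨ l , r , m ⟩
exec ⟨ p , r , m ⟩ (jumpZ x l)      = ⟨ (if r x ≡ᵇ 0 then l else suc p) , r , m ⟩

-- The machine halts exactly when the program counter leaves the program.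
step : Program → State → Maybe State
step A s = Maybe.map (exec s) (head (drop (pc s) A))

infix 4 _⊢_⇓[_]_

-- A ⊢ s ⇓[ t ] s′ : started in s, the program A halts in s′ after exactly
-- t steps.
data _⊢_⇓[_]_ (A : Program) : State → ℕ → State → Set where
  halted : ∀ {s} → step A s ≡ nothing → A ⊢ s ⇓[ 0 ] s
  next   : ∀ {s s′ s″ t} → step A s ≡ just s′ → A ⊢ s′ ⇓[ t ] s″ →
           A ⊢ s ⇓[ suc t ] s″

-- Input: registers 0 and 1 hold n and k; memory cells 0,…,n+k−1 hold
-- T(1),…,T(n),P(1),…,P(k) with values in {1,…,n} and {1,…,k}.  All other
-- registers and cells are 0.

encode : ∀ {m} → Permutation′ m → List ℕ
encode π = tabulate (λ i → suc (toℕ (π ⟨$⟩ʳ i)))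

initial : ∀ {n k} → Permutation′ n → Permutation′ k → State
initial {n} {k} T P = ⟨ 0 , registers , memory ⟩
  where
  registers : ℕ → ℕ
  registers 0 = n
  registers 1 = k
  registers _ = 0

  memory : ℕ → ℕ
  memory a = fromMaybe 0 (head (drop a (encode T ++ encode P)))

-- The answer is read off register 0.
AnswersCorrectly : ∀ {n k} → Permutation′ n → Permutation′ k → State → Set
AnswersCorrectly T P s =
  (HasMatching T P × reg s 0 ≡ 1) ⊎ (¬ HasMatching T P × reg s 0 ≡ 0)

SolvesPPM : Program → Set
SolvesPPM A = ∀ {n k} → k ≤ n → (T : Permutation′ n) (P : Permutation′ k) →
  ∃[ t ] ∃[ s ] (A ⊢ initial T P ⇓[ t ] s) × AnswersCorrectly T P s

-- Time O((p/q)ⁿ·n·k), with denominators cleared: t ≤ c·(p/q)ⁿ·n·k.  The empty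
-- pattern is exempt, as the bound would be 0 for it; it is not exempt from
-- correctness above.
RunsInTime-O[_/_]^n*n*k : ℕ → (q : ℕ) → .{{NonZero q}} → Program → Set
RunsInTime-O[ p / q ]^n*n*k A =
  ∃[ c ] (∀ {n k} → 1 ≤ k → k ≤ n → (T : Permutation′ n) (P : Permutation′ k) →
    ∀ {t s} → A ⊢ initial T P ⇓[ t ] s → t * q ^ n ≤ c * (p ^ n * n * k))

{-# OPTIONS --safe #-}

-- P matches into T exactly if P is a subsequence of r(T(1)),…,r(T(n)) for some weakly increasing
-- r : [n] → ℕ: such an r orders the text values that carry distinct pattern values.  For a matching M
-- one can take r(y) = 1 + #{v even : M(v) ≤ y} + #{v even : M(v) < y}, which is determined by the
-- set {M(2), M(4), …}.  This set has no two adjacent elements, hence at most one in each of the pairs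
-- {1,2}, {3,4}, …; so one of 3^⌈n/2⌉ candidates r suffices, and each is tested greedily.  A
-- candidate is a number x < 3^⌈n/2⌉ whose ternary digits give the elements of the set, and r is
-- recomputed from x for every text entry, which costs O(n²) per candidate.  The surplus factor n is
-- absorbed because √3 < 1.79.
module Submission where

open import Defs
open import Data.Bool using (true; false; if_then_else_)
open import Data.Fin as Fin using (Fin; toℕ)
open import Data.Fin.Permutation using (Permutation′; _⟨$⟩ʳ_; _⟨$⟩ˡ_; inverseˡ; inverseʳ)
open import Data.Fin.Properties using (toℕ<n)
open import Data.List using (List; []; _∷_; _++_; drop; head; length; map; tabulate)
open import Data.List.Properties using (++-identityʳ; tabulate-cong; map-tabulate; length-tabulate)
open import Data.List.Relation.Binary.Sublist.Propositional using (_⊆_; []; _∷_; _∷ʳ_; minimum)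
open import Data.List.Relation.Binary.Sublist.Propositional.Properties using (∷⁻¹; ∷ʳ⁻¹; map⁺)
open import Data.Maybe as Maybe using (Maybe; just; nothing; fromMaybe; _>>=_)
open import Data.Nat
open import Data.Nat.DivMod using ([m+kn]%n≡m%n; m<n⇒m%n≡m)
open import Data.Nat.Properties
open import Data.Nat.Tactic.RingSolver using (solve-∀)
open import Data.Product as Prod using (_×_; _,_; ∃-syntax; map₂)
open import Data.Sum as Sum using (_⊎_; inj₁; inj₂)
open import Function using (_∘_; Equivalence)
open import Relation.Binary.Core using (_Preserves_⟶_)
open import Relation.Binary.PropositionalEquality
open import Relation.Nullary using (¬_; yes; no; contradiction)

-- Machine states with listed registers, and simulation.

cell : List ℕ → ℕ → ℕ
cell l a = fromMaybe 0 (head (drop a l))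

-- A write past the end pads with zeros, in agreement with `cell`, which reads 0 there.
update : List ℕ → ℕ → ℕ → List ℕ
update []      zero    v = v ∷ []
update []      (suc a) v = 0 ∷ update [] a v
update (_ ∷ l) zero    v = v ∷ l
update (w ∷ l) (suc a) v = w ∷ update l a v

cell-[] : ∀ b → cell [] b ≡ 0
cell-[] zero    = refl
cell-[] (suc b) = refl

cell-update : ∀ l a v b → (cell l [ a ≔ v ]) b ≡ cell (update l a v) b
cell-update []      zero    v zero    = refl
cell-update []      zero    v (suc b) = sym (cell-[] b)
cell-update []      (suc a) v zero    = refl
cell-update []      (suc a) v (suc b) with cell-update [] a v b
... | eq with a ≡ᵇ b
... | true  = eq
... | false = trans (sym (cell-[] b)) eq
cell-update (w ∷ l) zero    v zero    = refl
cell-update (w ∷ l) zero    v (suc b) = refl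
cell-update (w ∷ l) (suc a) v zero    = refl
cell-update (w ∷ l) (suc a) v (suc b) = cell-update l a v b

-- A machine state whose registers are a list, padded with zeros: concrete programs then run on it
-- by evaluation, with no function equalities involved.
record Config : Set where
  constructor config
  field
    label  : ℕ
    regs   : List ℕ
    memory : ℕ → ℕ

open Config

execᶜ : Config → Instr → Config
execᶜ (config p l m) (const d v)      = config (suc p) (update l d v) m
execᶜ (config p l m) (move d x)       = config (suc p) (update l d (cell l x)) m
execᶜ (config p l m) (arith op d x y) = config (suc p) (update l d (⟦ op ⟧ (cell l x) (cell l y))) m
execᶜ (config p l m) (load d a)       = config (suc p) (update l d (m (cell l a))) m
execᶜ (config p l m) (store a x)      = config (suc p) l (m [ cell l a ≔ cell l x ])
execᶜ (config p l m) (jump q)         = config q l m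
execᶜ (config p l m) (jumpZ x q)      = config (if cell l x ≡ᵇ 0 then q else suc p) l m

stepᶜ : Program → Config → Maybe Config
stepᶜ A σ = Maybe.map (execᶜ σ) (head (drop (label σ) A))

run : Program → ℕ → Config → Maybe Config
run A zero    σ = just σ
run A (suc t) σ = stepᶜ A σ >>= run A t

infix 4 _∼_
record _∼_ (s : State) (σ : Config) : Set where
  constructor sim
  field
    pc-≡  : pc s ≡ label σ
    reg-≗ : reg s ≗ cell (regs σ)
    mem-≗ : mem s ≗ memory σ

open _∼_

cong-≔ : ∀ {f g} → f ≗ g → ∀ a {v w} → v ≡ w → f [ a ≔ v ] ≗ g [ a ≔ w ]
cong-≔ f≗g a v≡w b with a ≡ᵇ b
... | true  = v≡w
... | false = f≗g b

write-≗ : ∀ {r l} → r ≗ cell l → ∀ d {v w} → v ≡ w → r [ d ≔ v ] ≗ cell (update l d w)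
write-≗ {l = l} r≗l d {w = w} v≡w b = trans (cong-≔ r≗l d v≡w b) (cell-update l d w b)

exec-∼ : ∀ {s σ} → s ∼ σ → ∀ i → exec s i ∼ execᶜ σ i
exec-∼ (sim refl r m) (const d v)      = sim refl (write-≗ r d refl) m
exec-∼ (sim refl r m) (move d x)       = sim refl (write-≗ r d (r x)) m
exec-∼ (sim refl r m) (arith op d x y) = sim refl (write-≗ r d (cong₂ ⟦ op ⟧ (r x) (r y))) m
exec-∼ {⟨ _ , _ , f ⟩} (sim refl r m) (load d a) =
  sim refl (write-≗ r d (trans (cong f (r a)) (m _))) m
exec-∼ {⟨ _ , f , _ ⟩} {config _ l _} (sim refl r m) (store a x) rewrite r a =
  sim refl r (cong-≔ m (cell l a) (r x))
exec-∼ (sim refl r m) (jump q)         = sim refl r m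
exec-∼ (sim refl r m) (jumpZ x q) rewrite r x = sim refl r m

simulate : ∀ {A s σ τ} t → s ∼ σ → run A t σ ≡ just τ → stepᶜ A τ ≡ nothing →
           ∃[ s′ ] A ⊢ s ⇓[ t ] s′ × s′ ∼ τ
simulate {A} {s} {σ} zero s∼σ refl stuck with head (drop (pc s) A) in eq | pc-≡ s∼σ
... | nothing | refl = _ , halted (cong (Maybe.map (exec s)) eq) , s∼σ
... | just i  | refl rewrite eq = contradiction stuck λ ()
simulate {A} {s} {σ} (suc t) s∼σ ran stuck with head (drop (pc s) A) in eq | pc-≡ s∼σ
... | nothing | refl rewrite eq = contradiction ran λ ()
... | just i  | refl rewrite eq =
  map₂ (λ (h , s′∼τ) → next (cong (Maybe.map (exec s)) eq) h , s′∼τ)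
       (simulate t (exec-∼ s∼σ i) ran stuck)

-- The required time bound speaks of every halting run; determinism transfers it from the one run
-- that is constructed.
deterministic : ∀ {A s t t′ u u′} → A ⊢ s ⇓[ t ] u → A ⊢ s ⇓[ t′ ] u′ → t ≡ t′
deterministic (halted _)  (halted _)   = refl
deterministic (halted p)  (next q _)   = contradiction (trans (sym p) q) λ ()
deterministic (next p _)  (halted q)   = contradiction (trans (sym p) q) λ ()
deterministic (next p h)  (next q h′) with refl ← trans (sym p) q = cong suc (deterministic h h′)

-- Composing runs with step bounds.

run-+ : ∀ A t {t′ σ τ υ} → run A t σ ≡ just τ → run A t′ τ ≡ just υ → run A (t + t′) σ ≡ just υ
run-+ A zero    refl q = q
run-+ A (suc t) {σ = σ} p q with stepᶜ A σ
... | just _ = run-+ A t p q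

infix 4 _⊢_↝[_]_
-- The index bounds the step count from above, so that branches of different lengths share one
-- bound.
_⊢_↝[_]_ : Program → Config → ℕ → Config → Set
A ⊢ σ ↝[ b ] τ = ∃[ t ] t ≤ b × run A t σ ≡ just τ

↝-trans : ∀ {A σ τ υ b c} → A ⊢ σ ↝[ b ] τ → A ⊢ τ ↝[ c ] υ → A ⊢ σ ↝[ b + c ] υ
↝-trans {A} (t , t≤b , p) (u , u≤c , q) = t + u , +-mono-≤ t≤b u≤c , run-+ A t p q

↝-weaken : ∀ {A σ τ b c} → b ≤ c → A ⊢ σ ↝[ b ] τ → A ⊢ σ ↝[ c ] τ
↝-weaken b≤c (t , t≤b , p) = t , ≤-trans t≤b b≤c , p

↝-exactly : ∀ {A σ τ} t → run A t σ ≡ just τ → A ⊢ σ ↝[ t ] τ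
↝-exactly t p = t , ≤-refl , p

-- Candidates and the program.

-- For q = 3^b, chosen and lower read off the b-th ternary digit of x without a division: the b-th pair
-- of text values contains an element of the set if the digit is not 0, namely its lower value if the
-- digit is 2.
chosen : ℕ → ℕ → ℕ
chosen x q = 1 ∸ (q ∸ ⟦ mod ⟧ x (q * 3))

lower : ℕ → ℕ → ℕ
lower x q = 1 ∸ (q + q ∸ ⟦ mod ⟧ x (q * 3))

-- rank x 1 1 y is r(y + 1) for the candidate x: text values are counted from 0 here.  When a pair is
-- reached, c is 1 plus twice the number of set elements below it.
rank : ℕ → ℕ → ℕ → ℕ → ℕ
rank x q c (suc (suc y)) = rank x (q * 3) (c + chosen x q * 2) y
rank x q c y             = c + y * chosen x q + lower x q

-- Register x holds the candidate, p and a the addresses of the next text and pattern entries, ν and ρ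
-- the numbers of entries left.  Labels: 5 computes 3^⌈n/2⌉, 9 next candidate, 15 next text entry,
-- 23 rank, 40 comparison with the pattern, 48 accept, 50 reject.
matcher : Program
matcher =
  const x 1 ∷ const one 1 ∷ const two 2 ∷ const three 3 ∷ move t n ∷
  jumpZ t 9 ∷ arith mul x x three ∷ arith sub t t two ∷ jump 5 ∷
  jumpZ x 50 ∷ arith sub x x one ∷ const p 0 ∷ move ν n ∷ move a n ∷ move ρ k ∷
  jumpZ ρ 48 ∷ jumpZ ν 9 ∷ load y p ∷ arith add p one p ∷ arith sub ν ν one ∷
  arith sub y y one ∷ const c 1 ∷ const q 1 ∷
  arith mul r q three ∷ arith mod z x r ∷ arith sub u q z ∷ arith sub u one u ∷
  arith sub t y one ∷ jumpZ t 34 ∷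
  arith sub y y two ∷ arith mul u u two ∷ arith add c c u ∷ move q r ∷ jump 23 ∷
  arith mul u y u ∷ arith add c c u ∷ arith add q q q ∷ arith sub q q z ∷
  arith sub q one q ∷ arith add c c q ∷
  load t a ∷ arith sub u c t ∷ arith sub t t c ∷ arith add t u t ∷
  arith sub t one t ∷ arith add a t a ∷ arith sub ρ ρ t ∷ jump 15 ∷
  const n 1 ∷ jump 51 ∷
  const n 0 ∷ []
  where
  n k x one two three p ν a ρ y c q r z u t : Register
  n = 0; k = 1; x = 2; one = 3; two = 4; three = 5; p = 6; ν = 7; a = 8; ρ = 9
  y = 10; c = 11; q = 12; r = 13; z = 14; u = 15; t = 16

-- Correctness and step counts of the loops.

matchBit : ℕ → ℕ → ℕ
matchBit c v = 1 ∸ ((c ∸ v) + (v ∸ c))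

matchBit-≡ : ∀ {c v} → v ≡ c → matchBit c v ≡ 1
matchBit-≡ {c} refl rewrite n∸n≡0 c = refl

matchBit-≢ : ∀ {c v} → v ≢ c → matchBit c v ≡ 0
matchBit-≢ {zero}  {zero}  v≢c = contradiction refl v≢c
matchBit-≢ {zero}  {suc v} v≢c = 0∸n≡0 v
matchBit-≢ {suc c} {zero}  v≢c = 0∸n≡0 (c + 0)
matchBit-≢ {suc c} {suc v} v≢c = matchBit-≢ (v≢c ∘ cong suc)

data Holds (m : ℕ → ℕ) : ℕ → List ℕ → Set where
  []  : ∀ {a} → Holds m a []
  _∷_ : ∀ {a v l} → m a ≡ v → Holds m (suc a) l → Holds m a (v ∷ l)

holds-prefix : ∀ {m} a l l′ → (∀ b → m (a + b) ≡ cell (l ++ l′) b) → Holds m a l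
holds-prefix     a []      l′ eq = []
holds-prefix {m} a (v ∷ l) l′ eq =
  trans (cong m (sym (+-identityʳ a))) (eq 0) ∷
  holds-prefix (suc a) l l′ (λ b → trans (cong m (sym (+-suc a b))) (eq (suc b)))

cell-++ : ∀ l l′ b → cell (l ++ l′) (length l + b) ≡ cell l′ b
cell-++ []      l′ b = refl
cell-++ (_ ∷ l) l′ b = cell-++ l l′ b

holds-suffix : ∀ l l′ → Holds (cell (l ++ l′)) (length l) l′
holds-suffix l l′ = holds-prefix (length l) l′ []
  (λ b → trans (cell-++ l l′ b) (cong (λ l → cell l b) (sym (++-identityʳ l′))))

-- Per text entry: 8 steps before the rank loop, at most 12 + 6n in it, 8 for the comparison. The
-- final 2 pays for leaving the loop.
textTime : ℕ → ℕ → ℕ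
textTime n l = l * (28 + 6 * n) + 2

candidateTime : ℕ → ℕ
candidateTime n = 6 + textTime n n

matcherTime : ℕ → ℕ
matcherTime n = 5 + (1 + 4 * n) + (3 ^ ⌈ n /2⌉ * candidateTime n + 1) + 2

-- Registers that carry nothing from one text entry to the next, so that their final contents can
-- stay existential.
record Scratch : Set where
  constructor scratch
  field
    y q r z u t : ℕ

module _ (n k : ℕ) (m : ℕ → ℕ) where

  at : (l x p ν a ρ c : ℕ) → Scratch → Config
  at l x p ν a ρ c (scratch y q r z u t) =
    config l (n ∷ k ∷ x ∷ 1 ∷ 2 ∷ 3 ∷ p ∷ ν ∷ a ∷ ρ ∷ y ∷ c ∷ q ∷ r ∷ z ∷ u ∷ t ∷ []) m

  infix 4 _↝[_]_
  _↝[_]_ : Config → ℕ → Config → Set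
  σ ↝[ b ] τ = matcher ⊢ σ ↝[ b ] τ

  -- A pass over a full pair takes 11 steps, covered by the 12 that two values allot; the last pass
  -- takes 12.
  rank-loop : ∀ x p ν a ρ c y q r z u t → ∃[ s ]
    at 23 x p ν a ρ c (scratch y q r z u t) ↝[ 12 + 6 * y ] at 40 x p ν a ρ (rank x q c y) s
  rank-loop x p ν a ρ c zero q r z u t = _ , ↝-exactly 12 refl
  rank-loop x p ν a ρ c (suc zero) q r z u t = _ , ↝-weaken (m≤m+n 12 6) (↝-exactly 12 refl)
  rank-loop x p ν a ρ c (suc (suc y)) q r z u t =
    map₂ (λ h → ↝-weaken (enough y) (↝-trans (↝-exactly 11 refl) h))
         (rank-loop x p ν a ρ (c + chosen x q * 2) y (q * 3) _ _ _ _)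
    where
    enough : ∀ y → 11 + (12 + 6 * y) ≤ 12 + 6 * (2 + y)
    enough y = subst (23 + 6 * y ≤_) (lemma y) (n≤1+n _)
      where
      lemma : ∀ y → 24 + 6 * y ≡ 12 + 6 * (2 + y)
      lemma = solve-∀

  -- The match bit is added to the pattern position and subtracted from the number of entries left,
  -- so the comparison needs no branch.
  compare-step : ∀ {b} x p ν a ρ c s → matchBit c (m a) ≡ b → ∃[ s′ ]
    at 40 x p ν a ρ c s ↝[ 8 ] at 15 x p ν (b + a) (ρ ∸ b) c s′
  compare-step x p ν a ρ c s refl = _ , ↝-exactly 8 refl

  ranks : ℕ → List (Fin n) → List ℕ
  ranks x = map (rank x 1 1 ∘ toℕ)

  Run : Config → ℕ → (l x : ℕ) → Set
  Run σ b l x = ∃[ p ] ∃[ ν ] ∃[ a ] ∃[ ρ ] ∃[ c ] ∃[ s ] σ ↝[ b ] at l x p ν a ρ c s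

  prepend : ∀ {σ τ b c l x} → σ ↝[ b ] τ → Run τ c l x → Run σ (b + c) l x
  prepend h (p , ν , a , ρ , c , s , h′) = p , ν , a , ρ , c , s , ↝-trans h h′

  weaken : ∀ {σ b c l x} → b ≤ c → Run σ b l x → Run σ c l x
  weaken b≤c (p , ν , a , ρ , c , s , h) = p , ν , a , ρ , c , s , ↝-weaken b≤c h

  -- Greedy matching is exact: if the heads agree, a subsequence may as well use them (`∷⁻¹`); if
  -- they differ, it must skip the text entry (`∷ʳ⁻¹`).
  text-loop : ∀ x xs ps p a c s → Holds m p (map (suc ∘ toℕ) xs) → Holds m a ps →
    let σ = at 15 x p (length xs) a (length ps) c s; b = textTime n (length xs) in
    (ps ⊆ ranks x xs × Run σ b 48 x) ⊎ (¬ ps ⊆ ranks x xs × Run σ b 9 x)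
  text-loop x xs [] p a c s _ _ =
    inj₁ (minimum _ , _ , _ , _ , _ , _ , _ ,
          ↝-weaken (≤-trans (s≤s z≤n) (m≤n+m 2 _)) (↝-exactly 1 refl))
  text-loop x [] (v ∷ ps) p a c s _ _ =
    inj₂ ((λ ()) , _ , _ , _ , _ , _ , _ , ↝-exactly 2 refl)
  text-loop x (i ∷ xs) (v ∷ ps) p a c s (mp ∷ hxs) (ma ∷ hps) = result
    where
    R = rank x 1 1 (toℕ i)

    ranked : ∃[ s′ ] at 15 x p (suc (length xs)) a (suc (length ps)) c s
               ↝[ 8 + (12 + 6 * toℕ i) ] at 40 x (suc p) (length xs) a (suc (length ps)) R s′
    -- The run evaluates with `m p` symbolic; `mp` then identifies the loaded value, and the
    -- decrement turns it into a count from 0.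
    ranked = map₂ (↝-trans (subst (λ w → at 15 x p (suc (length xs)) a (suc (length ps)) c s
                                     ↝[ 8 ] at 23 x (suc p) (length xs) a (suc (length ps)) 1
                                              (scratch (w ∸ 1) 1 _ _ _ _))
                                  mp (↝-exactly 8 refl)))
                  (rank-loop x (suc p) (length xs) a (suc (length ps)) 1 (toℕ i) 1 _ _ _ _)

    lemma : ∀ i → 8 + (12 + i) + 8 ≡ 28 + i
    lemma = solve-∀

    iteration-time : 8 + (12 + 6 * toℕ i) + 8 ≤ 28 + 6 * n
    iteration-time = begin
      8 + (12 + 6 * toℕ i) + 8  ≡⟨ lemma (6 * toℕ i) ⟩
      28 + 6 * toℕ i            ≤⟨ +-monoʳ-≤ 28 (*-monoʳ-≤ 6 (<⇒≤ (toℕ<n i))) ⟩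
      28 + 6 * n                ∎
      where open ≤-Reasoning

    iteration : ∀ {b} → matchBit R (m a) ≡ b → ∃[ s′ ]
      at 15 x p (suc (length xs)) a (suc (length ps)) c s
        ↝[ 28 + 6 * n ] at 15 x (suc p) (length xs) (b + a) (suc (length ps) ∸ b) R s′
    iteration bit with ranked
    ... | s₁ , h = map₂ (↝-weaken iteration-time ∘ ↝-trans h) (compare-step x _ _ a _ R s₁ bit)

    then : ∀ {σ τ l} → σ ↝[ 28 + 6 * n ] τ → Run τ (textTime n (length xs)) l x →
           Run σ (textTime n (suc (length xs))) l x
    then h r = weaken (≤-reflexive (sym (+-assoc (28 + 6 * n) _ 2))) (prepend h r)

    result : (v ∷ ps ⊆ R ∷ ranks x xs × Run _ _ 48 x) ⊎ (¬ v ∷ ps ⊆ R ∷ ranks x xs × Run _ _ 9 x)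
    result with v ≟ R
    ... | yes v≡R with iteration (matchBit-≡ (trans ma v≡R))
    ... | s′ , h = Sum.map (Prod.map (v≡R ∷_) (then h))
                           (Prod.map (_∘ Equivalence.from (∷⁻¹ v≡R)) (then h))
                           (text-loop x xs ps (suc p) (suc a) R s′ hxs hps)
    result | no v≢R with iteration (matchBit-≢ (v≢R ∘ trans (sym ma)))
    ... | s′ , h = Sum.map (Prod.map (R ∷ʳ_) (then h))
                           (Prod.map (_∘ Equivalence.from (∷ʳ⁻¹ v≢R)) (then h))
                           (text-loop x xs (v ∷ ps) (suc p) a R s′ hxs (ma ∷ hps))

  -- The register is decremented before each test, so a start at `x` tries the candidates below `x`,
  -- downwards, until one succeeds.
  candidates : ∀ xs ps → length xs ≡ n → length ps ≡ k →
               Holds m 0 (map (suc ∘ toℕ) xs) → Holds m n ps → ∀ x p ν a ρ c s →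
    let σ = at 9 x p ν a ρ c s; b = x * candidateTime n + 1 in
    ((∃[ x′ ] ps ⊆ ranks x′ xs) × ∃[ x′ ] Run σ b 48 x′) ⊎
    ((∀ {x′} → x′ < x → ¬ ps ⊆ ranks x′ xs) × ∃[ x′ ] Run σ b 50 x′)
  candidates xs ps ∣xs∣ ∣ps∣ hxs hps zero p ν a ρ c s =
    inj₂ ((λ ()) , _ , _ , _ , _ , _ , _ , _ , ↝-exactly 1 refl)
  candidates xs ps ∣xs∣ ∣ps∣ hxs hps (suc x) p ν a ρ c s@(scratch _ _ _ _ _ _) =
    result (subst₂ Outcome ∣xs∣ ∣ps∣ (text-loop x xs ps 0 n c s hxs hps))
    where
    Outcome : ℕ → ℕ → Set
    Outcome w v = let σ = at 15 x 0 w n v c s; b = textTime n w in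
      (ps ⊆ ranks x xs × Run σ b 48 x) ⊎ (¬ ps ⊆ ranks x xs × Run σ b 9 x)

    start : at 9 (suc x) p ν a ρ c s ↝[ 6 ] at 15 x 0 n n k c s
    start = ↝-exactly 6 refl

    result : Outcome n k → _
    result (inj₁ (match , h)) =
      inj₁ ((x , match) , x , weaken (≤-trans (m≤m+n _ _) (m≤m+n _ 1)) (prepend start h))
    result (inj₂ (fails , _ , _ , _ , _ , _ , s′ , h)) =
      Sum.map (map₂ (map₂ retime)) (Prod.map all-fail (map₂ retime))
        (candidates xs ps ∣xs∣ ∣ps∣ hxs hps x _ _ _ _ _ s′)
      where
      retime : ∀ {l x′} → Run _ (x * candidateTime n + 1) l x′ →
               Run _ (suc x * candidateTime n + 1) l x′
      retime r = weaken (≤-reflexive (sym (+-assoc (candidateTime n) _ 1)))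
                        (prepend (↝-trans start h) r)

      all-fail : (∀ {x′} → x′ < x → ¬ ps ⊆ ranks x′ xs) →
                 ∀ {x′} → x′ < suc x → ¬ ps ⊆ ranks x′ xs
      all-fail earlier x′<1+x with m≤n⇒m<n∨m≡n (s≤s⁻¹ x′<1+x)
      ... | inj₁ x′<x = earlier x′<x
      ... | inj₂ refl = fails

  powerConfig : (l x t : ℕ) → Config
  powerConfig l x t = at l x 0 0 0 0 0 (scratch 0 0 0 0 0 t)

  power-loop : ∀ x t → powerConfig 5 x t ↝[ 1 + 4 * t ] powerConfig 9 (x * 3 ^ ⌈ t /2⌉) 0
  power-loop x zero          rewrite *-identityʳ x = ↝-exactly 1 refl
  -- Truncated subtraction takes the counter from 1 to 0, so an odd n still gets its last factor 3:
  -- the exponent is rounded up.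
  power-loop x (suc zero)    = ↝-exactly 5 refl
  power-loop x (suc (suc t)) =
    ↝-weaken (enough t)
      (subst (λ w → powerConfig 5 x (2 + t) ↝[ 4 + (1 + 4 * t) ] powerConfig 9 w 0)
             (*-assoc x 3 _)
             (↝-trans (↝-exactly 4 refl) (power-loop (x * 3) t)))
    where
    enough : ∀ t → 4 + (1 + 4 * t) ≤ 1 + 4 * (2 + t)
    enough t = subst (5 + 4 * t ≤_) (lemma t) (m≤n+m _ 4)
      where
      lemma : ∀ t → 4 + (5 + 4 * t) ≡ 1 + 4 * (2 + t)
      lemma = solve-∀

  Result : ℕ → Config → Set
  Result r σ = stepᶜ matcher σ ≡ nothing × cell (regs σ) 0 ≡ r

  matcher-run : ∀ xs ps → length xs ≡ n → length ps ≡ k →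
                Holds m 0 (map (suc ∘ toℕ) xs) → Holds m n ps →
    let σ = config 0 (n ∷ k ∷ []) m in
    ((∃[ x ] ps ⊆ ranks x xs) × ∃[ τ ] σ ↝[ matcherTime n ] τ × Result 1 τ) ⊎
    ((∀ {x} → x < 3 ^ ⌈ n /2⌉ → ¬ ps ⊆ ranks x xs) × ∃[ τ ] σ ↝[ matcherTime n ] τ × Result 0 τ)
  matcher-run xs ps ∣xs∣ ∣ps∣ hxs hps =
    Sum.map (map₂ accept) (map₂ reject)
            (candidates xs ps ∣xs∣ ∣ps∣ hxs hps (3 ^ ⌈ n /2⌉) 0 0 0 0 0 _)
    where
    σ = config 0 (n ∷ k ∷ []) m
    τ = powerConfig 9 (3 ^ ⌈ n /2⌉) 0

    setup : σ ↝[ 5 + (1 + 4 * n) ] τ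
    setup = ↝-trans (↝-exactly 5 refl)
              (subst (λ w → powerConfig 5 1 n ↝[ 1 + 4 * n ] powerConfig 9 w 0)
                     (*-identityˡ (3 ^ ⌈ n /2⌉)) (power-loop 1 n))

    accept : ∃[ x ] Run τ (3 ^ ⌈ n /2⌉ * candidateTime n + 1) 48 x →
             ∃[ υ ] σ ↝[ matcherTime n ] υ × Result 1 υ
    accept (x , _ , _ , _ , _ , _ , scratch _ _ _ _ _ _ , h) =
      _ , ↝-trans (↝-trans setup h) (↝-exactly 2 refl) , refl , refl

    reject : ∃[ x ] Run τ (3 ^ ⌈ n /2⌉ * candidateTime n + 1) 50 x →
             ∃[ υ ] σ ↝[ matcherTime n ] υ × Result 0 υ
    reject (x , _ , _ , _ , _ , _ , scratch _ _ _ _ _ _ , h) =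
      _ , ↝-trans (↝-trans setup h) (↝-weaken (n≤1+n 1) (↝-exactly 1 refl)) , refl , refl

-- Soundness: every candidate is weakly increasing.

lower≤chosen : ∀ x q → lower x q ≤ chosen x q
lower≤chosen x q = ∸-monoʳ-≤ 1 (∸-monoˡ-≤ (⟦ mod ⟧ x (q * 3)) (m≤m+n q q))

pair≤next : ∀ x q c → c + 1 * chosen x q + lower x q ≤ c + chosen x q * 2
pair≤next x q c = begin
  c + 1 * u + lower x q  ≤⟨ +-monoʳ-≤ (c + 1 * u) (lower≤chosen x q) ⟩
  c + 1 * u + u          ≡⟨ lemma c u ⟩
  c + u * 2              ∎
  where
  open ≤-Reasoning
  u = chosen x q
  lemma : ∀ c u → c + 1 * u + u ≡ c + u * 2
  lemma = solve-∀

pair-mono : ∀ x q c → c + 0 + lower x q ≤ c + 1 * chosen x q + lower x q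
pair-mono x q c = +-monoˡ-≤ (lower x q) (+-monoʳ-≤ c z≤n)

rank-lower-bound : ∀ x q c y → c ≤ rank x q c y
rank-lower-bound x q c zero          = ≤-trans (m≤m+n c 0) (m≤m+n _ _)
rank-lower-bound x q c (suc zero)    = ≤-trans (m≤m+n c _) (m≤m+n _ _)
rank-lower-bound x q c (suc (suc y)) = ≤-trans (m≤m+n c _) (rank-lower-bound x _ _ y)

-- Within a pair only `chosen` is added; entering the next pair raises `c` by twice `chosen`, which
-- covers `chosen` and `lower`.
rank-mono : ∀ x q c {y y′} → y ≤ y′ → rank x q c y ≤ rank x q c y′
rank-mono x q c {y′ = zero}        z≤n             = ≤-refl
rank-mono x q c {y′ = suc zero}    z≤n             = pair-mono x q c
rank-mono x q c {y′ = suc (suc y)} z≤n             =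
  ≤-trans (pair-mono x q c) (≤-trans (pair≤next x q c) (rank-lower-bound x _ _ y))
rank-mono x q c (s≤s (z≤n {zero}))  = ≤-refl
rank-mono x q c (s≤s (z≤n {suc y})) = ≤-trans (pair≤next x q c) (rank-lower-bound x _ _ y)
rank-mono x q c (s≤s (s≤s y≤y′))    = rank-mono x _ _ y≤y′

-- `g i` is the entry of `l` at the position that the embedding assigns to `i`.
unmap-tabulate : ∀ {A : Set} {k} {f : Fin k → ℕ} {r : A → ℕ} l → tabulate f ⊆ map r l →
                 ∃[ g ] (∀ i → f i ≡ r (g i)) × tabulate g ⊆ l
unmap-tabulate {k = zero}  l       _          = (λ ()) , (λ ()) , minimum l
unmap-tabulate {k = suc k} (a ∷ l) (_ ∷ʳ f⊆l) = map₂ (map₂ (a ∷ʳ_)) (unmap-tabulate l f⊆l)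
unmap-tabulate {k = suc k} (a ∷ l) (f₀≡ ∷ f⊆l) with unmap-tabulate l f⊆l
... | g , f≡ , g⊆l = (λ { Fin.zero → a ; (Fin.suc i) → g i })
                   , (λ { Fin.zero → f₀≡ ; (Fin.suc i) → f≡ i })
                   , refl ∷ g⊆l

module _ {n k} (T : Permutation′ n) (P : Permutation′ k) where

  sound : ∀ x → encode P ⊆ map (rank x 1 1 ∘ toℕ) (sequence T) → HasMatching T P
  sound x P⊆T with unmap-tabulate (sequence T) P⊆T
  ... | g , P≡ , g⊆T = M , M-mono , subst (_⊆ sequence T) (tabulate-cong g≗M) g⊆T
    where
    M : Fin k → Fin n
    M v = g (P ⟨$⟩ˡ v)

    g≗M : ∀ i → g i ≡ M (P ⟨$⟩ʳ i)
    g≗M i = cong g (sym (inverseˡ P))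

    rank-M : ∀ v → rank x 1 1 (toℕ (M v)) ≡ suc (toℕ v)
    rank-M v = trans (sym (P≡ (P ⟨$⟩ˡ v))) (cong (suc ∘ toℕ) (inverseʳ P))

    -- The rank of M(v) is the pattern value v itself, so M(w) ≤ M(v) would force w ≤ v.
    M-mono : M Preserves Fin._<_ ⟶ Fin._<_
    M-mono {v} {w} v<w = ≰⇒> λ Mw≤Mv →
      <⇒≱ v<w (s≤s⁻¹ (subst₂ _≤_ (rank-M w) (rank-M v) (rank-mono x 1 1 Mw≤Mv)))

-- Ternary digits of a candidate.

append-digit-< : ∀ {a q d e} → a < q → d < e → a + q * d < q * e
append-digit-< {a} {q} {d} {e} a<q d<e = begin-strict
  a + q * d  <⟨ +-monoˡ-< (q * d) a<q ⟩
  q + q * d  ≡⟨ *-suc q d ⟨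
  q * suc d  ≤⟨ *-monoʳ-≤ q d<e ⟩
  q * e      ∎
  where open ≤-Reasoning

-- For `q` = 3^b, `a` collects the digits below position b, `d` is the digit at b and `x` the digits
-- above, which the modulus removes.
remainder : ∀ {a q} d x → a < q → d < 3 →
            ⟦ mod ⟧ (a + q * (d + 3 * x)) (q * 3) ≡ a + q * d
remainder {a} {q@(suc _)} d x a<q d<3 = begin
  (a + q * (d + 3 * x)) % (q * 3)     ≡⟨ cong (_% (q * 3)) (lemma a q d x) ⟩
  (a + q * d + x * (q * 3)) % (q * 3) ≡⟨ [m+kn]%n≡m%n (a + q * d) x (q * 3) ⟩
  (a + q * d) % (q * 3)               ≡⟨ m<n⇒m%n≡m (append-digit-< a<q d<3) ⟩
  a + q * d                           ∎
  where
  open ≡-Reasoning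
  lemma : ∀ a q d x → a + q * (d + 3 * x) ≡ a + q * d + x * (q * 3)
  lemma = solve-∀

chosenDigit lowerDigit : ℕ → ℕ
chosenDigit d = 1 ∸ (1 ∸ d)
lowerDigit  d = 1 ∸ (2 ∸ d)

-- Since `a < q`, the number a + qd reaches qe exactly when d reaches e. The case e = 1 decodes
-- `chosen`, e = 2 decodes `lower`.
threshold : ∀ {a q} e d → a < q → 1 ∸ (q * e ∸ (a + q * d)) ≡ 1 ∸ (e ∸ d)
threshold {a} {q} e d a<q with e ≤? d
... | yes e≤d = cong (1 ∸_) (trans (m≤n⇒m∸n≡0 (≤-trans (*-monoʳ-≤ q e≤d) (m≤n+m _ a)))
                                   (sym (m≤n⇒m∸n≡0 e≤d)))
... | no e≰d = trans (m≤n⇒m∸n≡0 (m<n⇒0<n∸m (append-digit-< a<q (≰⇒> e≰d))))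
                        (sym (m≤n⇒m∸n≡0 (m<n⇒0<n∸m (≰⇒> e≰d))))

chosen-digit : ∀ {a q} d x → a < q → d < 3 → chosen (a + q * (d + 3 * x)) q ≡ chosenDigit d
chosen-digit {a} {q} d x a<q d<3 rewrite remainder d x a<q d<3 =
  trans (cong (λ w → 1 ∸ (w ∸ (a + q * d))) (sym (*-identityʳ q))) (threshold 1 d a<q)

lower-digit : ∀ {a q} d x → a < q → d < 3 → lower (a + q * (d + 3 * x)) q ≡ lowerDigit d
lower-digit {a} {q} d x a<q d<3 rewrite remainder d x a<q d<3 =
  trans (cong (λ w → 1 ∸ (w ∸ (a + q * d))) (double q)) (threshold 2 d a<q)
  where
  double : ∀ q → q + q ≡ q * 2
  double = solve-∀

-- Completeness: choosing the digits pair by pair.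

-- Before each pair, the next pattern value g to be matched is c or suc c: an odd pattern value c may
-- be matched before or inside the pair, as only even values occupy a digit.
Near : ℕ → ℕ → Set
Near c g = g ≡ c ⊎ g ≡ suc c

-- A rise of `g` marks a matched text value. The digit is nonzero exactly when the pattern value
-- `suc c` is matched inside the pair: 2 at its lower text value, 1 at its upper one.
choose-digit : ∀ {c g₀ g₁ g₂} → Near c g₀ → Near g₀ g₁ → Near g₁ g₂ → ∃[ d ] d < 3 ×
  (g₁ ≡ suc g₀ → c + 0 + lowerDigit d ≡ g₀) ×
  (g₂ ≡ suc g₁ → c + 1 * chosenDigit d + lowerDigit d ≡ g₁) ×
  Near (c + chosenDigit d * 2) g₂
choose-digit {c} (inj₁ refl) (inj₁ refl) (inj₁ refl) =
  0 , s≤s z≤n , (λ ()) , (λ ()) , inj₁ (sym (+-identityʳ c))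
choose-digit {c} (inj₁ refl) (inj₁ refl) (inj₂ refl) =
  0 , s≤s z≤n , (λ ()) , (λ _ → lemma c) , inj₂ (cong suc (sym (+-identityʳ c)))
  where
  lemma : ∀ c → c + 0 + 0 ≡ c
  lemma = solve-∀
choose-digit {c} (inj₁ refl) (inj₂ refl) (inj₁ refl) =
  0 , s≤s z≤n , (λ _ → lemma c) , (λ ()) , inj₂ (cong suc (sym (+-identityʳ c)))
  where
  lemma : ∀ c → c + 0 + 0 ≡ c
  lemma = solve-∀
choose-digit {c} (inj₁ refl) (inj₂ refl) (inj₂ refl) =
  1 , s≤s (s≤s z≤n) , (λ _ → lemma₀ c) , (λ _ → lemma₁ c) , inj₁ (+-comm 2 c)
  where
  lemma₀ : ∀ c → c + 0 + 0 ≡ c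
  lemma₀ = solve-∀
  lemma₁ : ∀ c → c + 1 + 0 ≡ suc c
  lemma₁ = solve-∀
choose-digit {c} (inj₂ refl) (inj₁ refl) (inj₁ refl) =
  0 , s≤s z≤n , (λ ()) , (λ ()) , inj₂ (cong suc (sym (+-identityʳ c)))
choose-digit {c} (inj₂ refl) (inj₁ refl) (inj₂ refl) =
  1 , s≤s (s≤s z≤n) , (λ ()) , (λ _ → lemma c) , inj₁ (+-comm 2 c)
  where
  lemma : ∀ c → c + 1 + 0 ≡ suc c
  lemma = solve-∀
choose-digit {c} (inj₂ refl) (inj₂ refl) (inj₁ refl) =
  2 , ≤-refl , (λ _ → lemma c) , (λ ()) , inj₁ (+-comm 2 c)
  where
  lemma : ∀ c → c + 0 + 1 ≡ suc c
  lemma = solve-∀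
choose-digit {c} (inj₂ refl) (inj₂ refl) (inj₂ refl) =
  2 , ≤-refl , (λ _ → lemma₀ c) , (λ _ → lemma₁ c) , inj₂ (cong suc (+-comm 2 c))
  where
  lemma₀ : ∀ c → c + 0 + 1 ≡ suc c
  lemma₀ = solve-∀
  lemma₁ : ∀ c → c + 1 + 1 ≡ suc (suc c)
  lemma₁ = solve-∀

Staircase : (ℕ → ℕ) → Set
Staircase g = ∀ y → Near (g y) (g (suc y))

-- Quantifying over the lower digits `a` lets the induction hypothesis at `q * 3` absorb the digit
-- just chosen. Agreement with `g` is only asked where `g` rises, that is, at matched values.
interpolate : ∀ h g c q → Staircase g → Near c (g 0) → ∃[ x ] x < 3 ^ h ×
  (∀ {a} → a < q → ∀ y → y < h * 2 → g (suc y) ≡ suc (g y) → rank (a + q * x) q c y ≡ g y)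
interpolate zero    g c q step near = 0 , s≤s z≤n , λ _ _ ()
interpolate (suc h) g c q step near with choose-digit near (step 0) (step 1)
... | d , d<3 , at₀ , at₁ , near′
    with interpolate h (g ∘ suc ∘ suc) (c + chosenDigit d * 2) (q * 3) (step ∘ suc ∘ suc) near′
... | x , x<3^h , interp = d + 3 * x , append-digit-< d<3 x<3^h , agree
  where
  agree : ∀ {a} → a < q → ∀ y → y < suc h * 2 → g (suc y) ≡ suc (g y) →
          rank (a + q * (d + 3 * x)) q c y ≡ g y
  agree {a} a<q zero _ rises
    rewrite lower-digit d x a<q d<3 = at₀ rises
  agree {a} a<q (suc zero) _ rises
    rewrite chosen-digit d x a<q d<3 | lower-digit d x a<q d<3 = at₁ rises
  agree {a} a<q (suc (suc y)) y<h rises rewrite chosen-digit d x a<q d<3 =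
    trans (cong (λ w → rank w (q * 3) (c + chosenDigit d * 2) y) (lemma a q d x))
          (interp (append-digit-< a<q d<3) y (s≤s⁻¹ (s≤s⁻¹ y<h)) rises)
    where
    lemma : ∀ a q d x → a + q * (d + 3 * x) ≡ (a + q * d) + q * 3 * x
    lemma = solve-∀

-- The staircase of a matching.

-- The number of v with M v < y, for increasing M only.
count : ∀ {n k} → (Fin k → Fin n) → ℕ → ℕ
count {k = zero}  M y = 0
count {k = suc k} M y with toℕ (M Fin.zero) <? y
... | yes _ = suc (count (M ∘ Fin.suc) y)
... | no  _ = 0

Increasing : ∀ {n k} → (Fin k → Fin n) → Set
Increasing M = M Preserves Fin._<_ ⟶ Fin._<_

Increasing-suc : ∀ {n k} {M : Fin (suc k) → Fin n} → Increasing M → Increasing (M ∘ Fin.suc)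
Increasing-suc inc v<w = inc (s≤s v<w)

count-above : ∀ {n k} (M : Fin k → Fin n) {y} → (∀ v → y ≤ toℕ (M v)) → count M y ≡ 0
count-above {k = zero}  M above = refl
count-above {k = suc k} M {y} above with toℕ (M Fin.zero) <? y
... | yes M₀<y = contradiction (above Fin.zero) (<⇒≱ M₀<y)
... | no  _    = refl

count-tail : ∀ {n k} (M : Fin (suc k) → Fin n) → Increasing M →
             count (M ∘ Fin.suc) (suc (toℕ (M Fin.zero))) ≡ 0
count-tail M inc = count-above (M ∘ Fin.suc) (λ v → inc (s≤s z≤n))

count-staircase : ∀ {n k} (M : Fin k → Fin n) → Increasing M → Staircase (count M)
count-staircase {k = zero}  M inc y = inj₁ refl
count-staircase {k = suc k} M inc y with toℕ (M Fin.zero) <? y | toℕ (M Fin.zero) <? suc y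
... | yes _    | yes _     = Sum.map (cong suc) (cong suc)
                               (count-staircase (M ∘ Fin.suc) (Increasing-suc inc) y)
... | yes M₀<y | no M₀≮1+y = contradiction (m<n⇒m<1+n M₀<y) M₀≮1+y
... | no _     | no _      = inj₁ refl
-- Here the first value of M equals y; the later ones are larger, so the count goes from 0 to 1.
... | no M₀≮y  | yes M₀<1+y with refl ← ≤-antisym (s≤s⁻¹ M₀<1+y) (≮⇒≥ M₀≮y) =
  inj₂ (cong suc (count-tail M inc))

count-at : ∀ {n k} (M : Fin k → Fin n) → Increasing M → ∀ v → count M (toℕ (M v)) ≡ toℕ v
count-at M inc Fin.zero with toℕ (M Fin.zero) <? toℕ (M Fin.zero)
... | yes M₀<M₀ = contradiction M₀<M₀ (<-irrefl refl)
... | no _      = refl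
count-at M inc (Fin.suc v) with toℕ (M Fin.zero) <? toℕ (M (Fin.suc v))
... | yes _     = cong suc (count-at (M ∘ Fin.suc) (Increasing-suc inc) v)
... | no M₀≮M₁₊ = contradiction (inc (s≤s z≤n)) M₀≮M₁₊

-- Together with `count-at`, this exhibits a rise of `count M` at each value of M, as `interpolate`
-- demands.
count-after : ∀ {n k} (M : Fin k → Fin n) → Increasing M → ∀ v →
              count M (suc (toℕ (M v))) ≡ suc (toℕ v)
count-after M inc Fin.zero with toℕ (M Fin.zero) <? suc (toℕ (M Fin.zero))
... | yes _      = cong suc (count-tail M inc)
... | no M₀≮1+M₀ = contradiction (n<1+n _) M₀≮1+M₀
count-after M inc (Fin.suc v) with toℕ (M Fin.zero) <? suc (toℕ (M (Fin.suc v)))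
... | yes _     = cong suc (count-after (M ∘ Fin.suc) (Increasing-suc inc) v)
... | no M₀≮1+M = contradiction (m<n⇒m<1+n (inc (s≤s z≤n))) M₀≮1+M

n≤⌈n/2⌉*2 : ∀ n → n ≤ ⌈ n /2⌉ * 2
n≤⌈n/2⌉*2 zero          = z≤n
n≤⌈n/2⌉*2 (suc zero)    = s≤s z≤n
n≤⌈n/2⌉*2 (suc (suc n)) = s≤s (s≤s (n≤⌈n/2⌉*2 n))

module _ {n k} (T : Permutation′ n) (P : Permutation′ k) where

  complete : HasMatching T P →
             ∃[ x ] x < 3 ^ ⌈ n /2⌉ × encode P ⊆ map (rank x 1 1 ∘ toℕ) (sequence T)
  complete (M , inc , MP⊆T)
    -- Encoded pattern values start at 1, hence the `suc`; it also makes the staircase start at the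
    -- initial counter 1.
    with interpolate ⌈ n /2⌉ (suc ∘ count M) 1 1
           (Sum.map (cong suc) (cong suc) ∘ count-staircase M inc)
           (inj₁ (cong suc (count-above M (λ _ → z≤n))))
  ... | x , x<3^h , interp = x , x<3^h , subst (_⊆ _) ranks-MP (map⁺ (rank x 1 1 ∘ toℕ) MP⊆T)
    where
    rank-M : ∀ v → rank x 1 1 (toℕ (M v)) ≡ suc (toℕ v)
    rank-M v = trans (cong (λ w → rank w 1 1 (toℕ (M v))) (sym (+-identityʳ x)))
      (trans (interp (s≤s z≤n) (toℕ (M v)) (<-≤-trans (toℕ<n (M v)) (n≤⌈n/2⌉*2 n))
               (cong suc (trans (count-after M inc v) (cong suc (sym (count-at M inc v))))))
             (cong suc (count-at M inc v)))

    ranks-MP : map (rank x 1 1 ∘ toℕ) (tabulate (λ i → M (P ⟨$⟩ʳ i))) ≡ encode P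
    ranks-MP = trans (map-tabulate (λ i → M (P ⟨$⟩ʳ i)) (rank x 1 1 ∘ toℕ))
                     (tabulate-cong (λ i → rank-M (P ⟨$⟩ʳ i)))

-- The time bound.

-- The summand 30 makes the induction step by 2 work, as 3·100²·(n + 32) ≤ 179²·(n + 30).
exponential-bound : ∀ n → (n + 30) * (3 ^ ⌈ n /2⌉ * 100 ^ n) ≤ 52 * 179 ^ n
exponential-bound zero       = m≤m+n 30 22
-- The sides are 9300 and 9308 = 52 · 179; this case determines the constant 52.
exponential-bound (suc zero) = m≤m+n 9300 8
exponential-bound (suc (suc n)) = begin
  (2 + n + 30) * (3 * w * (100 * (100 * v)))  ≡⟨ lemma₁ n w v ⟩
  (n * 30000 + 960000) * (w * v)              ≤⟨ *-monoˡ-≤ (w * v) (+-mono-≤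
                                                   (*-monoʳ-≤ n (m≤m+n 30000 2041))
                                                   (m≤m+n 960000 1230)) ⟩
  (n * 32041 + 961230) * (w * v)              ≡⟨ lemma₂ n (w * v) ⟩
  32041 * ((n + 30) * (w * v))                ≤⟨ *-monoʳ-≤ 32041 (exponential-bound n) ⟩
  32041 * (52 * 179 ^ n)                      ≡⟨ lemma₃ (179 ^ n) ⟩
  52 * (179 * (179 * 179 ^ n))                ∎
  where
  open ≤-Reasoning
  w = 3 ^ ⌈ n /2⌉
  v = 100 ^ n
  lemma₁ : ∀ n w v → (2 + n + 30) * (3 * w * (100 * (100 * v))) ≡ (n * 30000 + 960000) * (w * v)
  lemma₁ = solve-∀
  lemma₂ : ∀ n u → (n * 32041 + 961230) * u ≡ 32041 * ((n + 30) * u)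
  lemma₂ = solve-∀
  lemma₃ : ∀ u → 32041 * (52 * u) ≡ 52 * (179 * (179 * u))
  lemma₃ = solve-∀

-- One factor n is kept for the final bound; the other appears as n + 30, the form that
-- `exponential-bound` absorbs.
matcherTime-bound : ∀ n → 1 ≤ n → matcherTime n ≤ 6 * (n * ((n + 30) * 3 ^ ⌈ n /2⌉))
matcherTime-bound (suc j) _ with 3 ^ ⌈ suc j /2⌉ | m^n>0 3 ⌈ suc j /2⌉
... | suc v | _ = ≤-trans (m≤m+n time slack) (≤-reflexive (lemma j v))
  where
  time slack : ℕ
  time  = 5 + (1 + 4 * (1 + j)) + ((1 + v) * (6 + ((1 + j) * (28 + 6 * (1 + j)) + 2)) + 1) + 2
  -- The difference of the two sides, as a polynomial in j = n - 1 and v = 3^⌈n/2⌉ - 1; all its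
  -- coefficients are positive.
  slack = 131 + 148 * j + v * (144 + 152 * j)

  lemma : ∀ j v →
    5 + (1 + 4 * (1 + j)) + ((1 + v) * (6 + ((1 + j) * (28 + 6 * (1 + j)) + 2)) + 1) + 2 +
      (131 + 148 * j + v * (144 + 152 * j)) ≡
    6 * ((1 + j) * ((1 + j + 30) * (1 + v)))
  lemma = solve-∀

-- Assembling correctness and running time.

module _ {n k} (T : Permutation′ n) (P : Permutation′ k) where

  initial-∼ : initial T P ∼ config 0 (n ∷ k ∷ []) (cell (encode T ++ encode P))
  initial-∼ = sim refl (λ { 0 → refl ; 1 → refl ; (suc (suc i)) → sym (cell-[] i) }) (λ _ → refl)

  matcher-halts : ∃[ t ] ∃[ s ]
    t ≤ matcherTime n × (matcher ⊢ initial T P ⇓[ t ] s) × AnswersCorrectly T P s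
  matcher-halts with matcher-run n k (cell (encode T ++ encode P)) (sequence T) (encode P)
                       (length-tabulate _) (length-tabulate _) text-held pattern-held
    where
    text-held : Holds (cell (encode T ++ encode P)) 0 (map (suc ∘ toℕ) (sequence T))
    text-held = subst (Holds _ 0) (sym (map-tabulate (T ⟨$⟩ʳ_) (suc ∘ toℕ)))
                      (holds-prefix 0 (encode T) (encode P) (λ _ → refl))

    pattern-held : Holds (cell (encode T ++ encode P)) n (encode P)
    pattern-held = subst (λ a → Holds (cell (encode T ++ encode P)) a (encode P))
                         (length-tabulate {n = n} _)
                         (holds-suffix (encode T) (encode P))
  ... | inj₁ ((x , P⊆T) , τ , (t , t≤ , ran) , stuck , ans)
        with simulate t initial-∼ ran stuck
  ... | s , halts , s∼τ = t , s , t≤ , halts , inj₁ (sound T P x P⊆T , trans (reg-≗ s∼τ 0) ans)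
  matcher-halts
      | inj₂ (none , τ , (t , t≤ , ran) , stuck , ans)
        with simulate t initial-∼ ran stuck
  ... | s , halts , s∼τ = t , s , t≤ , halts , inj₂ (no-matching , trans (reg-≗ s∼τ 0) ans)
    where
    no-matching : ¬ HasMatching T P
    no-matching matching with complete T P matching
    ... | x , x<3^h , P⊆T = none x<3^h P⊆T

matcher-solves : SolvesPPM matcher
matcher-solves _ T P with matcher-halts T P
... | t , s , _ , halts , correct = t , s , halts , correct

matcher-fast : RunsInTime-O[ 179 / 100 ]^n*n*k matcher
-- 312 = 6 · 52, the constants of `matcherTime-bound` and `exponential-bound`; the factor k enters
-- through 1 ≤ k.
matcher-fast = 312 , bound
  where
  bound : ∀ {n k} → 1 ≤ k → k ≤ n → (T : Permutation′ n) (P : Permutation′ k) →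
          ∀ {t s} → matcher ⊢ initial T P ⇓[ t ] s → t * 100 ^ n ≤ 312 * (179 ^ n * n * k)
  bound {n} {k} 1≤k k≤n T P {t} run with matcher-halts T P
  ... | t′ , _ , t′≤ , run′ , _ with refl ← deterministic run run′ = begin
    t * 100 ^ n                                      ≤⟨ *-monoˡ-≤ (100 ^ n) (≤-trans t′≤
                                                          (matcherTime-bound n (≤-trans 1≤k k≤n))) ⟩
    6 * (n * ((n + 30) * 3 ^ ⌈ n /2⌉)) * 100 ^ n     ≡⟨ lemma₁ n (n + 30) (3 ^ ⌈ n /2⌉) (100 ^ n) ⟩
    6 * n * ((n + 30) * (3 ^ ⌈ n /2⌉ * 100 ^ n))     ≤⟨ *-monoʳ-≤ (6 * n) (exponential-bound n) ⟩
    6 * n * (52 * 179 ^ n)                           ≡⟨ lemma₂ n (179 ^ n) ⟩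
    312 * (179 ^ n * n * 1)                          ≤⟨ *-monoʳ-≤ 312 (*-monoʳ-≤ (179 ^ n * n) 1≤k) ⟩
    312 * (179 ^ n * n * k)                          ∎
    where
    open ≤-Reasoning
    lemma₁ : ∀ n e w v → 6 * (n * (e * w)) * v ≡ 6 * n * (e * (w * v))
    lemma₁ = solve-∀
    lemma₂ : ∀ n u → 6 * n * (52 * u) ≡ 312 * (u * n * 1)
    lemma₂ = solve-∀

corollary3p2 : ∃[ A ] (SolvesPPM A × RunsInTime-O[ 179 / 100 ]^n*n*k A)
corollary3p2 = matcher , matcher-solves , matcher-fast
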